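{- Let $\mathcal B=\{B_n\}_{n\in\mathbb N_1}$ be a Golomb system (with associated function $\gamma$) and $\kappa$ a Kirch function for $\mathcal B$. The space $(\mathbb Z,\mathcal T_{\mathcal B,\kappa})$ is Hausdorff if and only if for any two distinct $a,b\in\mathbb Z$ one can find a prime $p$ and an integer $r$ with $\gamma(p)\le r\le\kappa(p)$ such that $[a]_{p^r}$ and $[b]_{p^r}$ are two distinct points of $\mathbb Z/p^r\mathbb Z$, both lying outside $B_{p^r}$.
   Context: Notation: $\mathbb N=\{0,1,2,\dots\}$, $\mathbb N_1=\mathbb N-\{0\}$, $\mathcal P$ is the set of prime numbers, $v_p$ the $p$-adic valuation; $[a]_n$ is the class of $a$ in $\mathbb Z/n\mathbb Z$; for $n\mid m$, $\pi_n^m\colon\mathbb Z/m\mathbb Z\to\mathbb Z/n\mathbb Z$ is the natural projection. Golomb system: fix $\gamma\colon\mathcal P\to\mathbb N$ and, for each prime $p$, a nonempty subset $B_{p^{\gamma(p)}}\subseteq\mathbb Z/p^{\gamma(p)}\mathbb Z$, with $B_{p^{\gamma(p)}}\neq\mathbb Z/p^{\gamma(p)}\mathbb Z$ if $\gamma(p)>0$. Define $B_n\subseteq\mathbb Z/n\mathbb Z$ for all $n\in\mathbb N_1$ by: $B_1=\mathbb Z/1\mathbb Z$; $B_{p^r}=(\pi_{p^{\gamma(p)}}^{p^r})^{ -1}(B_{p^{\gamma(p)}})$ if $r\ge\gamma(p)$; $B_{p^r}=\pi_{p^r}^{p^{\gamma(p)}}(B_{p^{\gamma(p)}})$ if $r<\gamma(p)$;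 and $B_n=\bigcap_{p\mid n}(\pi^n_{p^{v_p(n)}})^{ -1}(B_{p^{v_p(n)}})$ in general. The family $\mathcal B=\{B_n\}_{n\in\mathbb N_1}$ is called a Golomb system. It is always assumed that $\gamma(p)$ is the smallest value giving rise to $\mathcal B$, i.e. the smallest $r$ such that $B_{p^s}=(\pi_{p^r}^{p^s})^{ -1}(B_{p^r})$ for all $s\ge r$. A Kirch function for $\mathcal B$ is a map $\kappa\colon\mathcal P\to\mathbb N\cup\{\infty\}$ with $\gamma(p)\le\kappa(p)$ for every $p$; it is always assumed that $\kappa(p)=0$ if $\gamma(p)=0$. The topology $\mathcal T_{\mathcal B,\kappa}$ on $\mathbb Z$ has as subbase the cosets $a+p^r\mathbb Z$ with $a\in\mathbb Z$, $p\in\mathcal P$, $r\in\mathbb N$, $\gamma(p)\le r\le\kappa(p)$ and $[a]_{p^r}\notin B_{p^r}$. -}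

module Defs where

open import Level using (Level; 0ℓ; _⊔_) renaming (suc to lsuc)
open import Data.Nat.Base using (ℕ; suc; _^_; _≤_; _<_; NonZero)
open import Data.Nat.Properties using (m^n≢0)
open import Data.Nat.Divisibility using (_∣_)
open import Data.Nat.Primality using (Prime; prime⇒nonZero)
open import Data.Integer.Base using (ℤ; +_) renaming (_+_ to _+ℤ_; _*_ to _*ℤ_)
open import Data.Integer.DivMod using (_%ℕ_; n%ℕd<d)
open import Data.Fin.Base using (Fin; toℕ; fromℕ<)
open import Data.List.Base using (List; foldr)
open import Data.List.Relation.Unary.All using (All)
open import Data.Product.Base using (Σ; ∃-syntax; _×_; _,_; proj₁)
open import Function.Bundles using (_⇔_)
open import Relation.Nullary.Negation.Core using (¬_)
open import Relation.Nullary.Construct.Add.Supremum using (_⁺; [_])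
open import Relation.Binary.PropositionalEquality.Core using (_≡_; _≢_)
import Relation.Binary.Construct.Add.Supremum.NonStrict as AddSupremum
open import Relation.Unary
  using (Pred; _∈_; _∉_; _⊆_; _≐_; _∩_; _⊥_; _⊢_; Satisfiable; Universal)
  renaming (U to Whole)

private
  variable
    ℓ : Level
    X : Set

open AddSupremum _≤_ public using (_≤⁺_)

ℕ∞ : Set
ℕ∞ = ℕ ⁺

-- `Prime p` is proof-irrelevant, so an element of 𝒫 is determined by
-- its first component.
𝒫 : Set
𝒫 = Σ ℕ Prime

record ℕ₁ : Set where
  constructor pos
  field
    value        : ℕ
    .{{nonZero}} : NonZero value

open ℕ₁ public using (value)

infixr 8 _^ₚ_

_^ₚ_ : 𝒫 → ℕ → ℕ₁
(p , prime-p) ^ₚ r = pos (p ^ r) {{m^n≢0 p r {{prime⇒nonZero prime-p}}}}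

ℤ/_ : ℕ₁ → Set
ℤ/ n = Fin (value n)

-- The class of a in ℤ/nℤ, represented by the least non-negative residue.
class : ∀ n → ℤ → ℤ/ n
class (pos n) a = fromℕ< (n%ℕd<d a n)

-- Reduction of residues modulo n. This is the natural projection
-- ℤ/mℤ → ℤ/nℤ when n ∣ m, and it is only used in that case.
π : ∀ m n → ℤ/ m → ℤ/ n
π m n x = class n (+ toℕ x)

image : ∀ {A B : Set} → (A → B) → Pred A 0ℓ → Pred B 0ℓ
image f P y = ∃[ x ] x ∈ P × f x ≡ y

IsValuation : 𝒫 → ℕ₁ → ℕ → Set
IsValuation (p , _) n v = p ^ v ∣ value n × ¬ (p ^ suc v ∣ value n)

-- The clauses B-one, B-above, B-below and B-general are the defining
-- equations of the family B in terms of γ and of the sets B (p ^ₚ γ p);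
-- they determine B up to extensional equality of subsets.
record GolombSystem : Set₁ where
  field
    γ : 𝒫 → ℕ
    B : ∀ n → Pred (ℤ/ n) 0ℓ

    B-nonempty : ∀ p → Satisfiable (B (p ^ₚ γ p))
    B-proper   : ∀ p → 0 < γ p → ¬ Universal (B (p ^ₚ γ p))

    B-one     : Universal (B (pos 1))
    B-above   : ∀ p r → γ p ≤ r →
                B (p ^ₚ r) ≐ π (p ^ₚ r) (p ^ₚ γ p) ⊢ B (p ^ₚ γ p)
    B-below   : ∀ p r → r < γ p →
                B (p ^ₚ r) ≐ image (π (p ^ₚ γ p) (p ^ₚ r)) (B (p ^ₚ γ p))
    B-general : ∀ n (x : ℤ/ n) →
                x ∈ B n ⇔
                (∀ p v → proj₁ p ∣ value n → IsValuation p n v →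
                 π n (p ^ₚ v) x ∈ B (p ^ₚ v))

    γ-minimal : ∀ p r →
                (∀ s → r ≤ s →
                 B (p ^ₚ s) ≐ π (p ^ₚ s) (p ^ₚ r) ⊢ B (p ^ₚ r)) →
                γ p ≤ r

record KirchFunction (𝓑 : GolombSystem) : Set where
  open GolombSystem 𝓑
  field
    κ      : 𝒫 → ℕ∞
    γ≤κ    : ∀ p → [ γ p ] ≤⁺ κ p
    κ-zero : ∀ p → γ p ≡ 0 → κ p ≡ [ 0 ]

⋂ᶠ : List (Pred X 0ℓ) → Pred X 0ℓ
⋂ᶠ = foldr _∩_ Whole

-- The family of open sets of the topology with subbase 𝒮: the unions of
-- finite intersections of members of 𝒮, the empty intersection being X.
Generated : Pred (Pred X 0ℓ) ℓ → Pred (Pred X 0ℓ) (lsuc 0ℓ ⊔ ℓ)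
Generated 𝒮 O =
  ∀ x → x ∈ O → ∃[ Vs ] All 𝒮 Vs × x ∈ ⋂ᶠ Vs × ⋂ᶠ Vs ⊆ O

Hausdorff : Pred (Pred X 0ℓ) ℓ → Set (lsuc 0ℓ ⊔ ℓ)
Hausdorff {X = X} 𝒯 =
  ∀ (x y : X) → x ≢ y →
  ∃[ O ] ∃[ O′ ] O ∈ 𝒯 × O′ ∈ 𝒯 × x ∈ O × y ∈ O′ × O ⊥ O′

coset : ℤ → ℕ₁ → Pred ℤ 0ℓ
coset a n x = ∃[ k ] x ≡ a +ℤ + value n *ℤ k

module _ (𝓑 : GolombSystem) (𝓚 : KirchFunction 𝓑) where
  open GolombSystem 𝓑
  open KirchFunction 𝓚

  Subbase : Pred (Pred ℤ 0ℓ) 0ℓ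
  Subbase O = ∃[ a ] ∃[ p ] ∃[ r ]
    γ p ≤ r × [ r ] ≤⁺ κ p × class (p ^ₚ r) a ∉ B (p ^ₚ r) ×
    O ≐ coset a (p ^ₚ r)

  KirchTopology : Pred (Pred ℤ 0ℓ) (lsuc 0ℓ)
  KirchTopology = Generated Subbase

{-# OPTIONS --safe #-}

-- All subbasic sets containing a are cosets of a itself, so a finite
-- intersection of them contains a + L ℤ, where L is the lcm of their moduli.
-- By the Chinese remainder theorem a + L ℤ and b + M ℤ are disjoint only if
-- gcd L M does not divide a − b. As gcd distributes over lcm, this failure is
-- already witnessed by a single pair of moduli p ^ r and q ^ s. Then p = q,
-- and a and b are distinct modulo p ^ min (r , s); both stay outside B there
-- because B is determined at level γ p ≤ min (r , s).

module Submission where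

open import Level using (0ℓ)
open import Data.Nat.Base as ℕ using (ℕ; zero; suc; _≤_; _^_; NonZero)
import Data.Nat.Properties as ℕ
import Data.Nat.Divisibility as ℕ
open import Data.Nat.GCD
open import Data.Nat.LCM
open import Data.Nat.Coprimality as Coprime using (Coprime; coprime-divisor)
open import Data.Nat.Primality using (Prime; prime⇒irreducible)
open import Data.Integer.Base hiding (_≤_; _⊔_; _^_; suc; NonZero)
open import Data.Integer.DivMod using (_/ℕ_; _%ℕ_; n%ℕd<d; a≡a%ℕn+[a/ℕn]*n)
open import Data.Integer.Divisibility.Signed
open import Data.Integer.Properties as ℤ using (pos-+; pos-*)
open import Data.Integer.Tactic.RingSolver using (solve-∀)
open import Data.Empty using (⊥)
open import Data.Fin.Base using (toℕ)
import Data.Fin.Properties as Fin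
open import Data.List.Base using (List; []; _∷_; foldr)
open import Data.List.Relation.Unary.All as All using (All; []; _∷_)
open import Data.Product.Base using (∃-syntax; _×_; _,_; proj₁; proj₂)
open import Data.Sum.Base as Sum using (_⊎_; inj₁; inj₂)
open import Data.Unit.Base using (tt)
open import Function.Base using (_∘_; id)
open import Function.Bundles using (_⇔_; mk⇔)
open import Relation.Nullary.Construct.Add.Supremum using ([_])
open import Relation.Nullary.Decidable.Core using (yes; no)
open import Relation.Nullary.Negation.Core using (contradiction)
open import Relation.Binary.PropositionalEquality
open import Relation.Unary using (Pred; _∈_; _∉_)
open import Defs

-- Congruences, cosets and residue classes

∣-−⇒∈coset : ∀ a x n → + value n ∣ x - a → x ∈ coset a n
∣-−⇒∈coset a x (pos n) (divides k eq) = k , (begin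
  x            ≡⟨ identity a x ⟩
  a + (x - a)  ≡⟨ cong (λ y → a + y) (trans eq (ℤ.*-comm k (+ n))) ⟩
  a + + n * k  ∎)
  where
  open ≡-Reasoning
  identity : ∀ a x → x ≡ a + (x - a)
  identity = solve-∀

∈coset⇒∣-− : ∀ a x n → x ∈ coset a n → + value n ∣ x - a
∈coset⇒∣-− a _ (pos n) (k , refl) = divides k (identity a (+ n) k)
  where
  identity : ∀ a n k → a + n * k - a ≡ k * n
  identity = solve-∀

∣-−-refl : ∀ {n} a → n ∣ a - a
∣-−-refl {n} a = divides 0ℤ (ℤ.+-inverseʳ a)

∣-−-sym : ∀ {n} a b → n ∣ a - b → n ∣ b - a
∣-−-sym a b n∣a-b = subst (_ ∣_) (identity a b) (∣m⇒∣-m n∣a-b)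
  where
  identity : ∀ a b → - (a - b) ≡ b - a
  identity = solve-∀

∣-−-trans : ∀ {n} a b c → n ∣ a - b → n ∣ b - c → n ∣ a - c
∣-−-trans a b c n∣a-b n∣b-c =
  subst (_ ∣_) (identity a b c) (∣m∣n⇒∣m+n n∣a-b n∣b-c)
  where
  identity : ∀ a b c → (a - b) + (b - c) ≡ a - c
  identity = solve-∀

∣-−-residue : ∀ a n .{{_ : NonZero n}} → + n ∣ a - + (a %ℕ n)
∣-−-residue a n = divides (a /ℕ n) (begin
  a - + r              ≡⟨ cong (_- + r) (a≡a%ℕn+[a/ℕn]*n a n) ⟩
  + r + q * + n - + r  ≡⟨ identity (+ r) (q * + n) ⟩
  q * + n              ∎)
  where
  open ≡-Reasoning
  r = a %ℕ n
  q = a /ℕ n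
  identity : ∀ r s → r + s - r ≡ s
  identity = solve-∀

-- The distance between `r` and `s` is at most their maximum, hence less than `n`, and the only
-- multiple of `n` below `n` is 0.
residues-unique : ∀ {n r s} → r ℕ.< n → s ℕ.< n → + n ∣ + r - + s → r ≡ s
residues-unique {n} {r} {s} r<n s<n n∣r-s =
  ℤ.+-injective (ℤ.i-j≡0⇒i≡j (+ r) (+ s) (ℤ.∣i∣≡0⇒i≡0 (small _ ∣r-s∣<n (∣⇒∣ᵤ n∣r-s))))
  where
  small : ∀ d → d ℕ.< n → n ℕ.∣ d → d ≡ 0
  small zero    _   _   = refl
  small (suc d) d<n n∣d = contradiction n∣d (ℕ.>⇒∤ d<n)
  ∣r-s∣<n : ∣ + r - + s ∣ ℕ.< n
  ∣r-s∣<n = ℕ.≤-<-trans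
    (subst (λ i → ∣ i ∣ ℕ.≤ r ℕ.⊔ s) (sym (ℤ.m-n≡m⊖n r s)) (ℤ.∣m⊝n∣≤m⊔n r s))
    (ℕ.⊔-pres-<m r<n s<n)

∣-−-class : ∀ n a → + value n ∣ a - + toℕ (class n a)
∣-−-class (pos n) a =
  subst (λ r → + n ∣ a - + r) (sym (Fin.toℕ-fromℕ< (n%ℕd<d a n))) (∣-−-residue a n)

class-cong : ∀ n a b → + value n ∣ a - b → class n a ≡ class n b
class-cong n a b n∣a-b = Fin.toℕ-injective (residues-unique
  (Fin.toℕ<n (class n a)) (Fin.toℕ<n (class n b))
  (∣-−-trans ra a rb (∣-−-sym a ra (∣-−-class n a))
    (∣-−-trans a b rb n∣a-b (∣-−-class n b))))
  where
  ra = + toℕ (class n a)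
  rb = + toℕ (class n b)

class-injective : ∀ n a b → class n a ≡ class n b → + value n ∣ a - b
class-injective n a b eq = ∣-−-trans a rb b
  (subst (λ c → + value n ∣ a - + toℕ c) eq (∣-−-class n a))
  (∣-−-sym b rb (∣-−-class n b))
  where
  rb = + toℕ (class n b)

-- The representative of `class m a` differs from `a` by a multiple of `m`, hence by a multiple of
-- `n`.
π-class : ∀ m n a → value n ℕ.∣ value m → π m n (class m a) ≡ class n a
π-class m n a n∣m = class-cong n r a
  (∣-−-sym a r (∣-trans (∣ᵤ⇒∣ n∣m) (∣-−-class m a)))
  where
  r = + toℕ (class m a)

-- Divisibility and coprimality of prime powers

^-monoʳ-∣ : ∀ n {r s} → r ≤ s → n ^ r ℕ.∣ n ^ s
^-monoʳ-∣ n {r} {s} r≤s = subst (n ^ r ℕ.∣_)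
  (trans (sym (ℕ.^-distribˡ-+-* n r (s ℕ.∸ r))) (cong (n ^_) (ℕ.m+[n∸m]≡n r≤s)))
  (ℕ.m∣m*n (n ^ (s ℕ.∸ r)))

-- A common divisor of `m` and `n * n ^ k` is coprime to `n`, because it divides `m`; it therefore
-- divides `n ^ k`, and induction applies.
coprime-^ʳ : ∀ {m n} k → Coprime m n → Coprime m (n ^ k)
coprime-^ʳ zero    _  = Coprime.sym (Coprime.1-coprimeTo _)
coprime-^ʳ (suc k) cp (d∣m , d∣n*n^k) = coprime-^ʳ k cp
  (d∣m , coprime-divisor (λ (e∣d , e∣n) → cp (ℕ.∣-trans e∣d d∣m , e∣n)) d∣n*n^k)

distinct-primes-coprime : ∀ {p q} → Prime p → Prime q → p ≢ q → Coprime p q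
distinct-primes-coprime p-prime q-prime p≢q (d∣p , d∣q)
  with prime⇒irreducible p-prime d∣p
... | inj₁ d≡1  = d≡1
... | inj₂ refl with prime⇒irreducible q-prime d∣q
...   | inj₁ d≡1 = d≡1
...   | inj₂ p≡q = contradiction p≡q p≢q

gcd-prime-powers : ∀ {p q} r s → Prime p → Prime q → p ≢ q →
                   gcd (p ^ r) (q ^ s) ≡ 1
gcd-prime-powers r s p-prime q-prime p≢q = Coprime.coprime⇒gcd≡1
  (coprime-^ʳ s (Coprime.sym (coprime-^ʳ r
    (Coprime.sym (distinct-primes-coprime p-prime q-prime p≢q)))))

-- Distributivity of gcd over lcm

-- With e = gcd m d, f = gcd n d and g = gcd e f, the product g d divides each
-- of m n, n d and e d, and e f is a combination of these.
∣lcm⇒∣lcm-gcd : ∀ {d} m n → d ℕ.∣ lcm m n → d ℕ.∣ lcm (gcd m d) (gcd n d)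
∣lcm⇒∣lcm-gcd {zero} m n 0∣lcm =
  subst₂ (λ x y → 0 ℕ.∣ lcm x y) (sym (gcd-identityʳ m)) (sym (gcd-identityʳ n)) 0∣lcm
∣lcm⇒∣lcm-gcd {d@(suc _)} m n d∣lcm = ℕ.*-cancelˡ-∣ g {{g≢0}} (begin
  g ℕ.* d        ∣⟨ g*d∣e*f ⟩
  e ℕ.* f        ≡⟨ gcd*lcm e f ⟨
  g ℕ.* lcm e f  ∎)
  where
  open ℕ.∣-Reasoning
  e = gcd m d
  f = gcd n d
  g = gcd e f
  g≢0 : NonZero g
  g≢0 = ℕ.≢-nonZero λ g≡0 →
    contradiction (gcd[m,n]≡0⇒n≡0 m (gcd[m,n]≡0⇒m≡0 g≡0)) λ ()
  g*d∣n*m : g ℕ.* d ℕ.∣ n ℕ.* m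
  g*d∣n*m = begin
    g ℕ.* d              ∣⟨ ℕ.*-pres-∣ (gcd-greatest
                              (ℕ.∣-trans (gcd[m,n]∣m e f) (gcd[m,n]∣m m d))
                              (ℕ.∣-trans (gcd[m,n]∣n e f) (gcd[m,n]∣m n d))) d∣lcm ⟩
    gcd m n ℕ.* lcm m n  ≡⟨ gcd*lcm m n ⟩
    m ℕ.* n              ≡⟨ ℕ.*-comm m n ⟩
    n ℕ.* m              ∎
  g*d∣e*n : g ℕ.* d ℕ.∣ e ℕ.* n
  g*d∣e*n = begin
    g ℕ.* d                  ∣⟨ gcd-greatest g*d∣n*m
                                  (ℕ.*-monoˡ-∣ d (ℕ.∣-trans (gcd[m,n]∣n e f) (gcd[m,n]∣m n d))) ⟩
    gcd (n ℕ.* m) (n ℕ.* d)  ≡⟨ c*gcd[m,n]≡gcd[cm,cn] n m d ⟨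
    n ℕ.* e                  ≡⟨ ℕ.*-comm n e ⟩
    e ℕ.* n                  ∎
  g*d∣e*f : g ℕ.* d ℕ.∣ e ℕ.* f
  g*d∣e*f = begin
    g ℕ.* d                  ∣⟨ gcd-greatest g*d∣e*n (ℕ.*-monoˡ-∣ d (gcd[m,n]∣m e f)) ⟩
    gcd (e ℕ.* n) (e ℕ.* d)  ≡⟨ c*gcd[m,n]≡gcd[cm,cn] e n d ⟨
    e ℕ.* f                  ∎

-- With `d = gcd (lcm m n) l`, the previous lemma bounds `d` by the lcm of `gcd m d` and `gcd n d`.
-- These divide `gcd m l` and `gcd n l`, since `d` divides `l`.
gcd-lcm-least : ∀ {k} l m n → gcd m l ℕ.∣ k → gcd n l ℕ.∣ k → gcd (lcm m n) l ℕ.∣ k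
gcd-lcm-least l m n m⊓l∣k n⊓l∣k = ℕ.∣-trans
  (∣lcm⇒∣lcm-gcd m n (gcd[m,n]∣m (lcm m n) l))
  (lcm-least (ℕ.∣-trans (shrink m) m⊓l∣k) (ℕ.∣-trans (shrink n) n⊓l∣k))
  where
  d = gcd (lcm m n) l
  shrink : ∀ x → gcd x d ℕ.∣ gcd x l
  shrink x = gcd-greatest (gcd[m,n]∣m x d)
    (ℕ.∣-trans (gcd[m,n]∣n x d) (gcd[m,n]∣n (lcm m n) l))

-- Bézout's identity and the Chinese remainder theorem

pos-identity : ∀ {d} m n x y → d ℕ.+ y ℕ.* n ≡ x ℕ.* m → + d + + y * + n ≡ + x * + m
pos-identity {d} m n x y eq = begin
  + d + + y * + n      ≡⟨ cong (λ z → + d + z) (pos-* y n) ⟨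
  + d + + (y ℕ.* n)    ≡⟨ pos-+ d (y ℕ.* n) ⟨
  + (d ℕ.+ y ℕ.* n)    ≡⟨ cong +_ eq ⟩
  + (x ℕ.* m)          ≡⟨ pos-* x m ⟩
  + x * + m            ∎
  where open ≡-Reasoning

-- Over ℕ the identity avoids subtraction and so comes in two forms, according to which multiple is
-- the larger; over ℤ both become one formula with signed coefficients.
bézout : ∀ m n → ∃[ u ] ∃[ v ] + gcd m n ≡ u * + m + v * + n
bézout m n with Bézout.identity (gcd-GCD m n)
... | Bézout.+- x y eq = + x , - + y , (begin
  + gcd m n                                  ≡⟨ identity (+ gcd m n) (+ y) (+ n) ⟩
  (+ gcd m n + + y * + n) + - + y * + n      ≡⟨ cong (_+ - + y * + n) (pos-identity m n x y eq) ⟩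
  + x * + m + - + y * + n                    ∎)
  where
  open ≡-Reasoning
  identity : ∀ g y n → g ≡ (g + y * n) + - y * n
  identity = solve-∀
... | Bézout.-+ x y eq = - + x , + y , (begin
  + gcd m n                                  ≡⟨ identity (+ gcd m n) (+ x) (+ m) ⟩
  - + x * + m + (+ gcd m n + + x * + m)      ≡⟨ cong (λ z → - + x * + m + z) (pos-identity n m y x eq) ⟩
  - + x * + m + + y * + n                    ∎)
  where
  open ≡-Reasoning
  identity : ∀ g x m → g ≡ - x * m + (g + x * m)
  identity = solve-∀

-- If `a - b = k * (u * m + v * n)`, then `a - k * u * m = b + k * v * n`, and this common value
-- solves both congruences.
chinese-remainder : ∀ m n a b → + gcd m n ∣ a - b →
                    ∃[ x ] (+ m ∣ x - a) × (+ n ∣ x - b)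
chinese-remainder m n a b (divides k eq) with u , v , gcd≡ ← bézout m n =
  a - k * u * + m ,
  divides (- (k * u)) (identity₁ a (k * u) (+ m)) ,
  divides (k * v) (begin
    a - k * u * + m - b                      ≡⟨ identity₂ a b (k * u * + m) ⟩
    (a - b) - k * u * + m                    ≡⟨ cong (_- k * u * + m) (trans eq (cong (λ g → k * g) gcd≡)) ⟩
    k * (u * + m + v * + n) - k * u * + m    ≡⟨ identity₃ k u v (+ m) (+ n) ⟩
    k * v * + n                              ∎)
  where
  open ≡-Reasoning
  identity₁ : ∀ a c m → a - c * m - a ≡ - c * m
  identity₁ = solve-∀
  identity₂ : ∀ a b c → a - c - b ≡ (a - b) - c
  identity₂ = solve-∀
  identity₃ : ∀ k u v m n → k * (u * m + v * n) - k * u * m ≡ k * v * n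
  identity₃ = solve-∀

-- Lcms of finite lists of prime powers

modulus : 𝒫 × ℕ → ℕ
modulus (p , r) = value (p ^ₚ r)

-- The empty list gets 1, in accordance with the empty intersection being all of ℤ.
lcms : List (𝒫 × ℕ) → ℕ
lcms = foldr (lcm ∘ modulus) 1

-- Carrying the alternative `Q` along turns the divisibility bound into a search: either every
-- modulus in the list passes, or an entry that yields `Q` is found. This keeps the argument
-- constructive.
gcd-lcms-least : ∀ {k} {Q : Set} l {qs} → All (λ q → gcd (modulus q) l ℕ.∣ k ⊎ Q) qs →
                 gcd (lcms qs) l ℕ.∣ k ⊎ Q
gcd-lcms-least {k} l [] = inj₁ (subst (ℕ._∣ k) (sym (gcd-zeroˡ l)) (ℕ.1∣ k))
gcd-lcms-least l (inj₂ found ∷ _) = inj₂ found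
gcd-lcms-least l {q ∷ qs} (inj₁ ∣k ∷ rest) with gcd-lcms-least l rest
... | inj₂ found = inj₂ found
... | inj₁ ∣k′   = inj₁ (gcd-lcm-least l (modulus q) (lcms qs) ∣k ∣k′)

-- Neighbourhoods and separation in the Kirch topology

module _ (𝓑 : GolombSystem) (𝓚 : KirchFunction 𝓑) where
  open GolombSystem 𝓑
  open KirchFunction 𝓚

  -- Expresses that the coset of `a` itself modulo `p ^ r` is a subbasic set.
  Admissible : ℤ → Pred (𝒫 × ℕ) 0ℓ
  Admissible a (p , r) = γ p ≤ r × [ r ] ≤⁺ κ p × class (p ^ₚ r) a ∉ B (p ^ₚ r)

  Separated : ℤ → ℤ → Set
  Separated a b = ∃[ p ] ∃[ r ]
    γ p ≤ r × [ r ] ≤⁺ κ p ×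
    class (p ^ₚ r) a ≢ class (p ^ₚ r) b ×
    class (p ^ₚ r) a ∉ B (p ^ₚ r) ×
    class (p ^ₚ r) b ∉ B (p ^ₚ r)

  -- A subbasic coset of `c` that contains `a` can be recentred: `a` and `c` have the same class, so
  -- the class of `a` avoids `B` as well. Being congruent to `a` modulo the lcm then gives
  -- membership in each coset.
  basic-neighbourhood : ∀ a {Vs} → All (Subbase 𝓑 𝓚) Vs → a ∈ ⋂ᶠ Vs →
    ∃[ qs ] All (Admissible a) qs × (∀ x → + lcms qs ∣ x - a → x ∈ ⋂ᶠ Vs)
  basic-neighbourhood a [] _ = [] , [] , λ _ _ → tt
  basic-neighbourhood a ((c , p , r , γ≤r , r≤κ , c∉B , V⊆coset , coset⊆V) ∷ Vs) (a∈V , a∈Vs)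
    with qs , adm , sub ← basic-neighbourhood a Vs a∈Vs =
    (p , r) ∷ qs ,
    (γ≤r , r≤κ , subst (_∉ B (p ^ₚ r)) (sym (class-cong (p ^ₚ r) a c a≡c)) c∉B) ∷ adm ,
    λ x x≡a →
      coset⊆V (∣-−⇒∈coset c x (p ^ₚ r) (∣-−-trans x a c
        (∣-trans (∣ᵤ⇒∣ (m∣lcm[m,n] (modulus (p , r)) (lcms qs))) x≡a) a≡c)) ,
      sub x (∣-trans (∣ᵤ⇒∣ (n∣lcm[m,n] (modulus (p , r)) (lcms qs))) x≡a)
    where
    a≡c : + modulus (p , r) ∣ a - c
    a≡c = ∈coset⇒∣-− c a (p ^ₚ r) (V⊆coset a∈V)

  -- At both levels `B-above` decides membership by the class at level `γ p`, so membership at `r`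
  -- would entail membership at `s`.
  ∉B-lower : ∀ p {r s} a → γ p ≤ r → r ≤ s →
             class (p ^ₚ s) a ∉ B (p ^ₚ s) → class (p ^ₚ r) a ∉ B (p ^ₚ r)
  ∉B-lower p {r} {s} a γ≤r r≤s a∉Bs a∈Br = a∉Bs (proj₂ (B-above p s γ≤s)
    (subst (_∈ B (p ^ₚ γ p)) (trans (π-γ γ≤r) (sym (π-γ γ≤s))) (proj₁ (B-above p r γ≤r) a∈Br)))
    where
    γ≤s = ℕ.≤-trans γ≤r r≤s
    π-γ : ∀ {t} → γ p ≤ t → π (p ^ₚ t) (p ^ₚ γ p) (class (p ^ₚ t) a) ≡ class (p ^ₚ γ p) a
    π-γ {t} γ≤t = π-class (p ^ₚ t) (p ^ₚ γ p) a (^-monoʳ-∣ (proj₁ p) γ≤t)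

  -- Equality of residue classes is decidable, and if the classes differ then `p` and `r` are the
  -- required witnesses.
  separated-or-congruent : ∀ {p r} a b → γ p ≤ r → [ r ] ≤⁺ κ p →
    class (p ^ₚ r) a ∉ B (p ^ₚ r) → class (p ^ₚ r) b ∉ B (p ^ₚ r) →
    value (p ^ₚ r) ℕ.∣ ∣ a - b ∣ ⊎ Separated a b
  separated-or-congruent {p} {r} a b γ≤r r≤κ a∉B b∉B
    with class (p ^ₚ r) a Fin.≟ class (p ^ₚ r) b
  ... | yes eq = inj₁ (∣⇒∣ᵤ (class-injective (p ^ₚ r) a b eq))
  ... | no neq = inj₂ (p , r , γ≤r , r≤κ , neq , a∉B , b∉B)

  -- Powers of distinct primes have gcd 1. For equal primes the gcd divides the lower power, so it
  -- suffices to compare `a` and `b` modulo that power, after bringing the point given at the higher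
  -- exponent down by `∉B-lower`.
  separated-or-compatible : ∀ a b {x y} → Admissible a x → Admissible b y →
    gcd (modulus x) (modulus y) ℕ.∣ ∣ a - b ∣ ⊎ Separated a b
  separated-or-compatible a b {(p , p-prime) , r} {(q , q-prime) , s}
    (γ≤r , r≤κ , a∉B) (γ≤s , s≤κ , b∉B) with p ℕ.≟ q
  ... | no p≢q = inj₁ (subst (ℕ._∣ ∣ a - b ∣)
    (sym (gcd-prime-powers r s p-prime q-prime p≢q)) (ℕ.1∣ _))
  ... | yes refl with ℕ.≤-total r s
  ...   | inj₁ r≤s = Sum.map₁ (ℕ.∣-trans (gcd[m,n]∣m (p ^ r) (p ^ s)))
    (separated-or-congruent a b γ≤r r≤κ a∉B (∉B-lower (p , p-prime) b γ≤r r≤s b∉B))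
  ...   | inj₂ s≤r = Sum.map₁ (ℕ.∣-trans (gcd[m,n]∣n (p ^ r) (p ^ s)))
    (separated-or-congruent a b γ≤s s≤κ (∉B-lower (p , p-prime) a γ≤s s≤r a∉B) b∉B)

  separated-or-lcms-compatible : ∀ a b {xs ys} → All (Admissible a) xs → All (Admissible b) ys →
    gcd (lcms xs) (lcms ys) ℕ.∣ ∣ a - b ∣ ⊎ Separated a b
  separated-or-lcms-compatible a b {xs} {ys} as bs =
    -- `gcd-lcms-least` replaces only the first argument of the gcd by an lcm, so it is used once
    -- for each list, with the arguments swapped in between.
    gcd-lcms-least (lcms ys) (All.map (λ {x} adm-x →
      Sum.map₁ (swap (lcms ys) (modulus x))
        (gcd-lcms-least (modulus x) (All.map (λ {y} adm-y →
          Sum.map₁ (swap (modulus x) (modulus y)) (separated-or-compatible a b adm-x adm-y)) bs))) as)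
    where
    swap : ∀ m n {k} → gcd m n ℕ.∣ k → gcd n m ℕ.∣ k
    swap m n {k} = subst (ℕ._∣ k) (gcd-comm m n)

  -- If the gcd of the two lcms divided `a - b`, the Chinese remainder theorem would produce a point
  -- common to both neighbourhoods.
  disjoint⇒separated : ∀ a b {xs ys} → All (Admissible a) xs → All (Admissible b) ys →
    (∀ z → + lcms xs ∣ z - a → + lcms ys ∣ z - b → ⊥) → Separated a b
  disjoint⇒separated a b {xs} {ys} as bs disjoint =
    Sum.[ (λ gcd∣a-b →
            let z , z≡a , z≡b = chinese-remainder (lcms xs) (lcms ys) a b (∣ᵤ⇒∣ gcd∣a-b)
            in contradiction z≡b (disjoint z z≡a))
        , id ]
      (separated-or-lcms-compatible a b as bs)

  -- The two implications

  hausdorff⇒separated : Hausdorff (KirchTopology 𝓑 𝓚) → ∀ a b → a ≢ b → Separated a b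
  hausdorff⇒separated hausdorff a b a≢b =
    let O , O′ , open-O , open-O′ , a∈O , b∈O′ , O⊥O′ = hausdorff a b a≢b
        Vs , Vs-subbasic , a∈Vs , Vs⊆O                = open-O a a∈O
        Ws , Ws-subbasic , b∈Ws , Ws⊆O′               = open-O′ b b∈O′
        xs , xs-admissible , xs⊆Vs                    = basic-neighbourhood a Vs-subbasic a∈Vs
        ys , ys-admissible , ys⊆Ws                    = basic-neighbourhood b Ws-subbasic b∈Ws
    in disjoint⇒separated a b xs-admissible ys-admissible
         λ z z≡a z≡b → O⊥O′ (Vs⊆O (xs⊆Vs z z≡a) , Ws⊆O′ (ys⊆Ws z z≡b))

  -- The coset is subbasic, so as a one-member intersection it serves as a neighbourhood of each of
  -- its points.
  coset-open : ∀ a {p r} → γ p ≤ r → [ r ] ≤⁺ κ p → class (p ^ₚ r) a ∉ B (p ^ₚ r) →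
               coset a (p ^ₚ r) ∈ KirchTopology 𝓑 𝓚
  coset-open a {p} {r} γ≤r r≤κ a∉B x x∈V =
    coset a (p ^ₚ r) ∷ [] ,
    (a , p , r , γ≤r , r≤κ , a∉B , id , id) ∷ [] ,
    (x∈V , tt) , proj₁

  separated⇒hausdorff : (∀ a b → a ≢ b → Separated a b) → Hausdorff (KirchTopology 𝓑 𝓚)
  separated⇒hausdorff separated a b a≢b
    with p , r , γ≤r , r≤κ , a≢b[p^r] , a∉B , b∉B ← separated a b a≢b =
    coset a (p ^ₚ r) , coset b (p ^ₚ r) ,
    coset-open a γ≤r r≤κ a∉B , coset-open b γ≤r r≤κ b∉B ,
    ∣-−⇒∈coset a a (p ^ₚ r) (∣-−-refl a) , ∣-−⇒∈coset b b (p ^ₚ r) (∣-−-refl b) ,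
    -- A point `x` in both cosets would make `a` and `b` congruent modulo `p ^ r` through `x`.
    λ { {x} (x∈a , x∈b) → a≢b[p^r] (class-cong (p ^ₚ r) a b (∣-−-trans a x b
          (∣-−-sym x a (∈coset⇒∣-− a x (p ^ₚ r) x∈a)) (∈coset⇒∣-− b x (p ^ₚ r) x∈b))) }

proposition2p40 :
    (𝓑 : GolombSystem) (𝓚 : KirchFunction 𝓑) →
    let open GolombSystem 𝓑
        open KirchFunction 𝓚
    in
    Hausdorff (KirchTopology 𝓑 𝓚) ⇔
    (∀ (a b : ℤ) → a ≢ b →
      ∃[ p ] ∃[ r ]
        γ p ≤ r × [ r ] ≤⁺ κ p ×
        class (p ^ₚ r) a ≢ class (p ^ₚ r) b ×
        class (p ^ₚ r) a ∉ B (p ^ₚ r) ×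
        class (p ^ₚ r) b ∉ B (p ^ₚ r))
proposition2p40 𝓑 𝓚 = mk⇔ (hausdorff⇒separated 𝓑 𝓚) (separated⇒hausdorff 𝓑 𝓚)
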